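{- Let $G$ be a $3$-degenerate triangle-free graph with $m$ vertices and no independent set of size $r$. Then $e(G)\ge 6m-13r-1$.
   Context: A graph is $3$-degenerate if every subgraph has a vertex of degree at most $3$. $e(G)$ is the number of edges. -}

module Defs where

open import Data.Nat using (ℕ; _≤_)
open import Data.Bool using (Bool; true; false; T; _∧_)
open import Data.Bool.Properties using (T?)
open import Data.Fin using (Fin; _<_)
open import Data.Fin.Properties using (_<?_)
open import Data.Fin.Subset using (Subset; _∈_; ∣_∣; Nonempty)
open import Data.List using (List; filter; length; allFin; cartesianProduct)
open import Data.Product using (_×_; _,_; ∃; proj₁; proj₂)
open import Relation.Nullary using (¬_)
open import Relation.Nullary.Decidable using (_×-dec_)
open import Relation.Binary.PropositionalEquality using (_≡_)

record Graph (n : ℕ) : Set where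
  field
    adj       : Fin n → Fin n → Bool
    symmetric : ∀ i j → adj i j ≡ adj j i
    loopless  : ∀ i → adj i i ≡ false
open Graph public

Adj : ∀ {n} → Graph n → Fin n → Fin n → Set
Adj G i j = T (adj G i j)

edgeCount : ∀ {n} → Graph n → ℕ
edgeCount {n} G =
  length (filter (λ p → (proj₁ p <? proj₂ p) ×-dec T? (adj G (proj₁ p) (proj₂ p)))
                 (cartesianProduct (allFin n) (allFin n)))

degreeIn : ∀ {n} → Graph n → Subset n → Fin n → ℕ
degreeIn {n} G S v =
  length (filter (λ u → T? (adj G v u ∧ Data.Vec.lookup S u)) (allFin n))
  where import Data.Vec

Degenerate : ∀ {n} → ℕ → Graph n → Set
Degenerate {n} k G =
  (S : Subset n) → Nonempty S → ∃ λ v → v ∈ S × degreeIn G S v ≤ k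

TriangleFree : ∀ {n} → Graph n → Set
TriangleFree {n} G = ∀ (a b c : Fin n) → ¬ (Adj G a b × Adj G b c × Adj G a c)

Independent : ∀ {n} → Graph n → Subset n → Set
Independent {n} G S = ∀ (u v : Fin n) → u ∈ S → v ∈ S → ¬ Adj G u v

NoIndependentSetOfSize : ∀ {n} → Graph n → ℕ → Set
NoIndependentSetOfSize {n} G r = (S : Subset n) → Independent G S → ¬ (∣ S ∣ ≡ r)

{-# OPTIONS --safe #-}
module Submission where

-- Write f = e - 6n + 13α.  Deleting the closed neighbourhood of a vertex v of degree d, whose
-- neighbours have degree sum z, lowers α by at least one and e by exactly z (no triangles), so
-- f(G) ≥ f(G - N[v]) + z - 6(d + 1) + 13.  Three claims are proved by simultaneous induction:
-- (A) f ≥ 0; (B) f ≥ 1 if some vertex has degree ≤ 2; (C) f ≥ 2 if all degrees are ≤ 3 and the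
-- total deficiency Σ (3 - deg) is at least 6.
-- In (C), deleting the closed neighbourhood of a 2-vertex with z ≥ 5 costs nothing and does not
-- decrease the deficiency; otherwise the 2-vertices near v form a path along which one deletes.
-- In (A), a 3-vertex with a neighbour of degree ≥ 4 leads to (B).  If there is none,
-- 3-degeneracy forces the graph to be cubic, and deleting the closed neighbourhood of any vertex
-- leaves a graph of deficiency 6, to which (C) applies; since z = 9, this step costs 2.

open import Defs
open import Data.Nat using (ℕ)
open import Data.Integer using (ℤ; +_; _-_; _*_; _≤_)

import Data.Integer as ℤ
import Data.Integer.Properties as ℤₚ
import Algebra.Properties.CommutativeMonoid.Sum
open import Data.Bool using (Bool; true; false; T; _∧_; _∨_; not; if_then_else_)
open import Data.Bool.Properties using (T?; T-∧; T-∨; T-≡)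
open import Data.Empty using (⊥-elim)
open import Data.Fin using (Fin; zero; suc; _≟_)
import Data.Fin as Fin
import Data.Fin.Properties as Finₚ
open import Data.Fin.Properties using (any?)
import Data.Fin.Subset as Sub
import Data.Fin.Subset.Properties as Subₚ
open import Data.List using (List; []; _∷_; filter; length; tabulate; map; cartesianProduct; _++_)
open import Data.List.Properties using (filter-++; length-++; length-map)
import Data.Nat as ℕ
open import Data.Nat using (zero; suc; s≤s; z≤n; _≤ᵇ_; _≤?_)
open import Data.Nat.Induction using (<-wellFounded)
import Data.Nat.Properties as ℕₚ
open import Data.Nat.Tactic.RingSolver using (solve-∀)
open import Data.Product using (_×_; _,_; ∃; ∃₂; proj₁; proj₂)
open import Data.Sum using (inj₁; inj₂)
open import Data.Unit using (tt)
import Data.Vec as Vec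
import Data.Vec.Properties as Vecₚ
open import Function using (_∘_; Equivalence)
open import Induction.WellFounded using (Acc; acc)
open import Relation.Binary using (tri<; tri≈; tri>)
open import Relation.Binary.PropositionalEquality
  using (_≡_; _≢_; refl; sym; trans; cong; cong₂; subst; subst₂; _≗_; module ≡-Reasoning)
open import Relation.Nullary using (¬_; Dec; yes; no; does; contradiction)
open import Relation.Nullary.Decidable using (_×-dec_; dec-true; dec-false)
open import Relation.Unary using (Decidable)

module ℕ-Sum = Algebra.Properties.CommutativeMonoid.Sum ℕₚ.+-0-commutativeMonoid
open ℕ-Sum using (sum; sum-cong-≗; ∑-distrib-+; ∑-comm; sum-replicate-zero)

private variable
  n : ℕ

-- Sums over sets of vertices

-- Boolean functions rather than `Subset` vectors: set operations then compute pointwise, and a sum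
-- over a set is a full sum with a conditional. The subsets of the statement are translated at the
-- end.
VSet : ℕ → Set
VSet n = Fin n → Bool

infix 4 _∈_ _∉_ _⊆_
_∈_ _∉_ : Fin n → VSet n → Set
u ∈ X = T (X u)
u ∉ X = ¬ u ∈ X

_⊆_ : VSet n → VSet n → Set
X ⊆ Y = ∀ u → u ∈ X → u ∈ Y

infixl 7 _∩_
infixl 6 _∖_
_∩_ : VSet n → VSet n → VSet n
(X ∩ P) u = X u ∧ P u

∁ : VSet n → VSet n
∁ P u = not (P u)

_∖_ : VSet n → Fin n → VSet n
(X ∖ a) u = X u ∧ not (does (u ≟ a))

insert : Fin n → VSet n → VSet n
insert v I u = I u ∨ does (u ≟ v)

∈-∩⁺ : ∀ {b c} → T b → T c → T (b ∧ c)
∈-∩⁺ p q = Equivalence.from T-∧ (p , q)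

∈-∩⁻ : ∀ {b c} → T (b ∧ c) → T b × T c
∈-∩⁻ = Equivalence.to T-∧

T-not⁺ : ∀ {b} → ¬ T b → T (not b)
T-not⁺ {true}  ¬b = ¬b tt
T-not⁺ {false} ¬b = tt

T-not⁻ : ∀ {b} → T (not b) → ¬ T b
T-not⁻ {false} _ b = b

∈-∖⁺ : {X : VSet n} {u a : Fin n} → u ∈ X → u ≢ a → u ∈ X ∖ a
∈-∖⁺ {u = u} {a} u∈X u≢a rewrite dec-false (u ≟ a) u≢a = ∈-∩⁺ u∈X tt

∈-∖⁻ : {X : VSet n} {u a : Fin n} → u ∈ X ∖ a → u ∈ X × u ≢ a
∈-∖⁻ {u = u} {a} u∈ with u ≟ a
... | yes _  = ⊥-elim (proj₂ (∈-∩⁻ u∈))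
... | no u≢a = proj₁ (∈-∩⁻ u∈) , u≢a

sum-mono : {f g : Fin n → ℕ} → (∀ u → f u ℕ.≤ g u) → sum f ℕ.≤ sum g
sum-mono {zero}  f≤g = z≤n
sum-mono {suc n} f≤g = ℕₚ.+-mono-≤ (f≤g zero) (sum-mono (f≤g ∘ suc))

sum-const-0 : {f : Fin n → ℕ} → (∀ u → f u ≡ 0) → sum f ≡ 0
sum-const-0 {n} f≡0 = trans (sum-cong-≗ f≡0) (sum-replicate-zero n)

sum-select : (a : Fin n) (f : Fin n → ℕ) → sum (λ u → if does (u ≟ a) then f u else 0) ≡ f a
sum-select {suc n} zero    f =
  trans (cong (f zero ℕ.+_) (sum-replicate-zero n)) (ℕₚ.+-identityʳ (f zero))
sum-select (suc a) f = sum-select a (f ∘ suc)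

-- Opaque so that X and f can be inferred from ∑∈ X f.
opaque
  ∑∈ : VSet n → (Fin n → ℕ) → ℕ
  ∑∈ X f = sum (λ u → if X u then f u else 0)

  ∑∈-cong : {X : VSet n} {f g : Fin n → ℕ} → (∀ u → u ∈ X → f u ≡ g u) → ∑∈ X f ≡ ∑∈ X g
  ∑∈-cong {X = X} {f} {g} f≡g = sum-cong-≗ pointwise
    where
    pointwise : ∀ u → (if X u then f u else 0) ≡ (if X u then g u else 0)
    pointwise u with X u | f≡g u
    ... | true  | eq = eq tt
    ... | false | _  = refl

  -- Exports the definition past the opaque barrier.
  ∑∈-sum : (X : VSet n) (f : Fin n → ℕ) → ∑∈ X f ≡ sum (λ u → if X u then f u else 0)
  ∑∈-sum X f = refl

  ∑∈-cong-≗ : {X Y : VSet n} (f : Fin n → ℕ) → X ≗ Y → ∑∈ X f ≡ ∑∈ Y f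
  ∑∈-cong-≗ f X≗Y = sum-cong-≗ (λ u → cong (λ b → if b then f u else 0) (X≗Y u))

  ∑∈-mono : {X : VSet n} {f g : Fin n → ℕ} → (∀ u → u ∈ X → f u ℕ.≤ g u) → ∑∈ X f ℕ.≤ ∑∈ X g
  ∑∈-mono {X = X} {f} {g} f≤g = sum-mono pointwise
    where
    pointwise : ∀ u → (if X u then f u else 0) ℕ.≤ (if X u then g u else 0)
    pointwise u with X u | f≤g u
    ... | true  | le = le tt
    ... | false | _  = z≤n

  ∑∈-mono-⊆ : {X Y : VSet n} (f : Fin n → ℕ) → X ⊆ Y → ∑∈ X f ℕ.≤ ∑∈ Y f
  ∑∈-mono-⊆ {X = X} {Y} f X⊆Y = sum-mono pointwise
    where
    pointwise : ∀ u → (if X u then f u else 0) ℕ.≤ (if Y u then f u else 0)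
    pointwise u with X u | Y u | X⊆Y u
    ... | false | _     | _  = z≤n
    ... | true  | true  | _  = ℕₚ.≤-refl
    ... | true  | false | le = ⊥-elim (le tt)

  ∑∈-zero : {X : VSet n} {f : Fin n → ℕ} → (∀ u → u ∈ X → f u ≡ 0) → ∑∈ X f ≡ 0
  ∑∈-zero {X = X} f≡0 = trans (∑∈-cong f≡0) (sum-const-0 pointwise)
    where
    pointwise : ∀ u → (if X u then 0 else 0) ≡ 0
    pointwise u with X u
    ... | true  = refl
    ... | false = refl

  ∑∈-+ : (X : VSet n) (f g : Fin n → ℕ) → ∑∈ X (λ u → f u ℕ.+ g u) ≡ ∑∈ X f ℕ.+ ∑∈ X g
  ∑∈-+ X f g = trans (sum-cong-≗ pointwise)
    (∑-distrib-+ (λ u → if X u then f u else 0) (λ u → if X u then g u else 0))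
    where
    pointwise : ∀ u → (if X u then f u ℕ.+ g u else 0)
                    ≡ (if X u then f u else 0) ℕ.+ (if X u then g u else 0)
    pointwise u with X u
    ... | true  = refl
    ... | false = refl

  ∑∈-∩ : (X P : VSet n) (f : Fin n → ℕ) → ∑∈ (X ∩ P) f ≡ ∑∈ X (λ u → if P u then f u else 0)
  ∑∈-∩ X P f = sum-cong-≗ pointwise
    where
    pointwise : ∀ u → (if X u ∧ P u then f u else 0) ≡ (if X u then (if P u then f u else 0) else 0)
    pointwise u with X u
    ... | true  = refl
    ... | false = refl

  ∑∈-split : (X P : VSet n) (f : Fin n → ℕ) → ∑∈ X f ≡ ∑∈ (X ∩ P) f ℕ.+ ∑∈ (X ∩ ∁ P) f
  ∑∈-split X P f = trans (sum-cong-≗ pointwise)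
    (∑-distrib-+ (λ u → if (X ∩ P) u then f u else 0) (λ u → if (X ∩ ∁ P) u then f u else 0))
    where
    pointwise : ∀ u → (if X u then f u else 0)
                    ≡ (if X u ∧ P u then f u else 0) ℕ.+ (if X u ∧ not (P u) then f u else 0)
    pointwise u with X u | P u
    ... | true  | true  = sym (ℕₚ.+-identityʳ (f u))
    ... | true  | false = refl
    ... | false | _     = refl

  ∑∈-remove : {X : VSet n} {a : Fin n} (f : Fin n → ℕ) → a ∈ X → ∑∈ X f ≡ f a ℕ.+ ∑∈ (X ∖ a) f
  ∑∈-remove {X = X} {a} f a∈X = begin
    ∑∈ X f                                                      ≡⟨ sum-cong-≗ pointwise ⟩
    sum (λ u → (if does (u ≟ a) then f u else 0) ℕ.+
               (if (X ∖ a) u then f u else 0))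
      ≡⟨ ∑-distrib-+ (λ u → if does (u ≟ a) then f u else 0) (λ u → if (X ∖ a) u then f u else 0) ⟩
    sum (λ u → if does (u ≟ a) then f u else 0) ℕ.+ ∑∈ (X ∖ a) f
      ≡⟨ cong (ℕ._+ ∑∈ (X ∖ a) f) (sum-select a f) ⟩
    f a ℕ.+ ∑∈ (X ∖ a) f                                        ∎
    where
    open ≡-Reasoning
    pointwise : ∀ u → (if X u then f u else 0)
                    ≡ (if does (u ≟ a) then f u else 0) ℕ.+ (if (X ∖ a) u then f u else 0)
    pointwise u with u ≟ a
    pointwise u | yes refl rewrite Equivalence.to T-≡ a∈X = sym (ℕₚ.+-identityʳ (f u))
    pointwise u | no _ with X u
    ... | true  = refl
    ... | false = refl

  -- Double counting: with both conditions moved inside, this is an exchange of two sums over all of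
  -- `Fin n`.
  ∑∈-comm : (X Y : VSet n) (h : Fin n → Fin n → ℕ) →
            ∑∈ X (λ u → ∑∈ Y (h u)) ≡ ∑∈ Y (λ w → ∑∈ X (λ u → h u w))
  ∑∈-comm {n} X Y h = begin
    ∑∈ X (λ u → ∑∈ Y (h u))                                              ≡⟨ sum-cong-≗ inward ⟩
    sum (λ u → sum (λ w → if X u then (if Y w then h u w else 0) else 0))
      ≡⟨ ∑-comm (λ u w → if X u then (if Y w then h u w else 0) else 0) ⟩
    sum (λ w → sum (λ u → if X u then (if Y w then h u w else 0) else 0)) ≡⟨ sum-cong-≗ outward ⟩
    ∑∈ Y (λ w → ∑∈ X (λ u → h u w))                                      ∎
    where
    open ≡-Reasoning
    inward : ∀ u → (if X u then ∑∈ Y (h u) else 0)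
                 ≡ sum (λ w → if X u then (if Y w then h u w else 0) else 0)
    inward u with X u
    ... | true  = refl
    ... | false = sym (sum-replicate-zero n)
    outward : ∀ w → sum (λ u → if X u then (if Y w then h u w else 0) else 0)
                  ≡ (if Y w then ∑∈ X (λ u → h u w) else 0)
    outward w with Y w
    ... | true  = refl
    ... | false = ∑∈-zero {X = X} (λ _ _ → refl)

size : VSet n → ℕ
size X = ∑∈ X (λ _ → 1)

indicator : Bool → ℕ
indicator b = if b then 1 else 0

∑∈-const : (X : VSet n) (k : ℕ) → k ℕ.* size X ≡ ∑∈ X (λ _ → k)
∑∈-const X zero    = sym (∑∈-zero (λ _ _ → refl))
∑∈-const X (suc k) = trans (cong (size X ℕ.+_) (∑∈-const X k)) (sym (∑∈-+ X (λ _ → 1) (λ _ → k)))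

size-remove : {X : VSet n} {a : Fin n} → a ∈ X → size X ≡ suc (size (X ∖ a))
size-remove = ∑∈-remove (λ _ → 1)

size-insert : {I : VSet n} {v : Fin n} → v ∉ I → size (insert v I) ≡ suc (size I)
size-insert {I = I} {v} v∉I = begin
  size (insert v I)           ≡⟨ size-remove v∈ ⟩
  suc (size (insert v I ∖ v)) ≡⟨ cong suc (∑∈-cong-≗ (λ _ → 1) restore) ⟩
  suc (size I)                ∎
  where
  open ≡-Reasoning
  v∈ : v ∈ insert v I
  v∈ = Equivalence.from T-∨ (inj₂ (Equivalence.from T-≡ (dec-true (v ≟ v) refl)))
  restore : insert v I ∖ v ≗ I
  restore u with u ≟ v
  restore u | yes refl with I u
  ... | true  = ⊥-elim (v∉I tt)
  ... | false = refl
  restore u | no _ with I u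
  ... | true  = refl
  ... | false = refl

size-empty : {X : VSet n} → ¬ ∃ (_∈ X) → size X ≡ 0
size-empty X∅ = ∑∈-zero (λ u u∈X → ⊥-elim (X∅ (u , u∈X)))

pick : {X : VSet n} → 1 ℕ.≤ size X → ∃ (_∈ X)
pick {X = X} 1≤ with any? (λ u → T? (X u))
... | yes u∈ = u∈
... | no X∅  = contradiction (subst (1 ℕ.≤_) (size-empty X∅) 1≤) λ ()

pick-another : {X : VSet n} {a : Fin n} → a ∈ X → 2 ℕ.≤ size X → ∃ λ b → b ∈ X × b ≢ a
pick-another {X = X} a∈X 2≤
  with b , b∈ ← pick (ℕ.s≤s⁻¹ (subst (2 ℕ.≤_) (size-remove {X = X} a∈X) 2≤))
  = b , ∈-∖⁻ {X = X} b∈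

-- One element is fixed in advance because a particular neighbour is usually in hand already: the
-- vertex just come from, or one of large degree.
pick-two-more : {X : VSet n} {a : Fin n} → a ∈ X → 3 ℕ.≤ size X →
                ∃₂ λ b c → (b ∈ X × b ≢ a) × (c ∈ X × c ≢ a) × c ≢ b
pick-two-more {X = X} {a} a∈X 3≤
  with 2≤ ← ℕ.s≤s⁻¹ (subst (3 ℕ.≤_) (size-remove {X = X} a∈X) 3≤)
  with b , b∈ ← pick {X = X ∖ a} (ℕₚ.≤-trans (s≤s z≤n) 2≤)
  with c , c∈ , c≢b ← pick-another {X = X ∖ a} b∈ 2≤
  = b , c , ∈-∖⁻ {X = X} b∈ , ∈-∖⁻ {X = X} c∈ , c≢b

-- Linear arithmetic: a ≤ b follows from x ≤ y when b + x exceeds a + y by the slack c.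
≤-combine : ∀ {x y} a b c → x ℕ.≤ y → a ℕ.+ y ℕ.+ c ≡ b ℕ.+ x → a ℕ.≤ b
≤-combine {x} {y} a b c x≤y eq = ℕₚ.+-cancelʳ-≤ x a b (begin
  a ℕ.+ x         ≤⟨ ℕₚ.+-monoʳ-≤ a x≤y ⟩
  a ℕ.+ y         ≤⟨ ℕₚ.m≤m+n _ c ⟩
  a ℕ.+ y ℕ.+ c   ≡⟨ eq ⟩
  b ℕ.+ x         ∎)
  where open ℕₚ.≤-Reasoning

-- Degrees, neighbourhoods and deletion of a closed neighbourhood

module _ (G : Graph n) where

  -- Also meant for `v` outside `X`, where it counts the edges from `v` into `X`; `degreeSum-rest`
  -- relies on this.
  deg : VSet n → Fin n → ℕ
  deg X v = ∑∈ X (λ u → indicator (adj G v u))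

  degreeSum : VSet n → ℕ
  degreeSum X = ∑∈ X (deg X)

  nbrs : VSet n → Fin n → VSet n
  nbrs X v = X ∩ adj G v

  -- The quantity z of the overview.
  nbrDegreeSum : VSet n → Fin n → ℕ
  nbrDegreeSum X v = ∑∈ (nbrs X v) (deg X)

  rest : VSet n → Fin n → VSet n
  rest X v = X ∩ ∁ (adj G v) ∖ v

  adj-sym : ∀ {u v} → Adj G u v → Adj G v u
  adj-sym {u} {v} = subst T (symmetric G u v)

  adj⇒≢ : ∀ {u v} → Adj G u v → u ≢ v
  adj⇒≢ {u} uv refl = subst T (loopless G u) uv

  nbr-sym : ∀ {X v a} → v ∈ X → a ∈ nbrs X v → v ∈ nbrs X a
  nbr-sym v∈X a∈ = ∈-∩⁺ v∈X (adj-sym (proj₂ (∈-∩⁻ a∈)))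

  deg≡size-nbrs : ∀ X v → deg X v ≡ size (nbrs X v)
  deg≡size-nbrs X v = sym (∑∈-∩ X (adj G v) (λ _ → 1))

  deg-positive : ∀ {X v a} → a ∈ nbrs X v → 1 ℕ.≤ deg X v
  deg-positive {X} {v} a∈ =
    subst (1 ℕ.≤_) (sym (trans (deg≡size-nbrs X v) (size-remove {X = nbrs X v} a∈))) (s≤s z≤n)

  pick-nbr : ∀ {X v} → 1 ℕ.≤ deg X v → ∃ (_∈ nbrs X v)
  pick-nbr {X} {v} = pick ∘ subst (1 ℕ.≤_) (deg≡size-nbrs X v)

  pick-other-nbr : ∀ {X v a} → a ∈ nbrs X v → 2 ℕ.≤ deg X v → ∃ λ b → b ∈ nbrs X v × b ≢ a
  pick-other-nbr {X} {v} a∈ = pick-another {X = nbrs X v} a∈ ∘ subst (2 ℕ.≤_) (deg≡size-nbrs X v)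

  pick-two-more-nbrs : ∀ {X v a} → a ∈ nbrs X v → 3 ℕ.≤ deg X v →
    ∃₂ λ b c → (b ∈ nbrs X v × b ≢ a) × (c ∈ nbrs X v × c ≢ a) × c ≢ b
  pick-two-more-nbrs {X} {v} a∈ =
    pick-two-more {X = nbrs X v} a∈ ∘ subst (3 ℕ.≤_) (deg≡size-nbrs X v)

  nbrDegreeSum≥₁ : ∀ {X v a p} → a ∈ nbrs X v → p ℕ.≤ deg X a → p ℕ.≤ nbrDegreeSum X v
  nbrDegreeSum≥₁ {X} {v} {a} {p} a∈ p≤ = begin
    p                                      ≤⟨ p≤ ⟩
    deg X a                                ≤⟨ ℕₚ.m≤m+n _ _ ⟩
    deg X a ℕ.+ ∑∈ (nbrs X v ∖ a) (deg X)  ≡⟨ ∑∈-remove {X = nbrs X v} (deg X) a∈ ⟨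
    nbrDegreeSum X v                       ∎
    where open ℕₚ.≤-Reasoning

  -- Separate bounds `p` and `q` let the sum compute to the numeral that is passed to
  -- `Surplus-rest`.
  nbrDegreeSum≥₂ : ∀ {X v a b p q} → a ∈ nbrs X v → b ∈ nbrs X v → b ≢ a →
    p ℕ.≤ deg X a → q ℕ.≤ deg X b → p ℕ.+ q ℕ.≤ nbrDegreeSum X v
  nbrDegreeSum≥₂ {X} {v} {a} {b} {p} {q} a∈ b∈ b≢a p≤ q≤ = begin
    p ℕ.+ q                                                  ≤⟨ ℕₚ.+-mono-≤ p≤ q≤ ⟩
    deg X a ℕ.+ deg X b                                      ≤⟨ ℕₚ.+-monoʳ-≤ (deg X a) (ℕₚ.m≤m+n _ _) ⟩
    deg X a ℕ.+ (deg X b ℕ.+ ∑∈ (nbrs X v ∖ a ∖ b) (deg X))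
      ≡⟨ cong (deg X a ℕ.+_) (∑∈-remove {X = nbrs X v ∖ a} (deg X) (∈-∖⁺ {X = nbrs X v} b∈ b≢a)) ⟨
    deg X a ℕ.+ ∑∈ (nbrs X v ∖ a) (deg X)                    ≡⟨ ∑∈-remove {X = nbrs X v} (deg X) a∈ ⟨
    nbrDegreeSum X v                                         ∎
    where open ℕₚ.≤-Reasoning

  nbrDegreeSum≥₃ : ∀ {X v a b c p q r} → a ∈ nbrs X v →
    b ∈ nbrs X v × b ≢ a → c ∈ nbrs X v × c ≢ a → c ≢ b →
    p ℕ.≤ deg X a → q ℕ.≤ deg X b → r ℕ.≤ deg X c → p ℕ.+ (q ℕ.+ r) ℕ.≤ nbrDegreeSum X v
  nbrDegreeSum≥₃ {X} {v} {a} {b} {c} {p} {q} {r} a∈ (b∈ , b≢a) (c∈ , c≢a) c≢b p≤ q≤ r≤ = begin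
    p ℕ.+ (q ℕ.+ r)                        ≤⟨ ℕₚ.+-mono-≤ p≤ (ℕₚ.+-mono-≤ q≤ r≤) ⟩
    deg X a ℕ.+ (deg X b ℕ.+ deg X c)
      ≤⟨ ℕₚ.+-monoʳ-≤ (deg X a) (ℕₚ.+-monoʳ-≤ (deg X b) (ℕₚ.m≤m+n _ _)) ⟩
    deg X a ℕ.+ (deg X b ℕ.+ (deg X c ℕ.+ ∑∈ (nbrs X v ∖ a ∖ b ∖ c) (deg X)))
      ≡⟨ cong (λ s → deg X a ℕ.+ (deg X b ℕ.+ s)) (∑∈-remove {X = nbrs X v ∖ a ∖ b} (deg X)
           (∈-∖⁺ {X = nbrs X v ∖ a} (∈-∖⁺ {X = nbrs X v} c∈ c≢a) c≢b)) ⟨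
    deg X a ℕ.+ (deg X b ℕ.+ ∑∈ (nbrs X v ∖ a ∖ b) (deg X))
      ≡⟨ cong (deg X a ℕ.+_) (∑∈-remove {X = nbrs X v ∖ a} (deg X) (∈-∖⁺ {X = nbrs X v} b∈ b≢a)) ⟨
    deg X a ℕ.+ ∑∈ (nbrs X v ∖ a) (deg X)  ≡⟨ ∑∈-remove {X = nbrs X v} (deg X) a∈ ⟨
    nbrDegreeSum X v                       ∎
    where open ℕₚ.≤-Reasoning

  deg-mono : ∀ {X Y} → Y ⊆ X → ∀ w → deg Y w ℕ.≤ deg X w
  deg-mono Y⊆X w = ∑∈-mono-⊆ _ Y⊆X

  ∈-rest⁻ : ∀ {X v u} → u ∈ rest X v → u ∈ X × ¬ Adj G v u × u ≢ v
  ∈-rest⁻ {X} {v} {u} u∈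
    with u∈′ , u≢v ← ∈-∖⁻ {X = X ∩ ∁ (adj G v)} u∈
    with u∈X , ¬vu ← ∈-∩⁻ u∈′
    = u∈X , T-not⁻ ¬vu , u≢v

  ∈-rest⁺ : ∀ {X v u} → u ∈ X → ¬ Adj G v u → u ≢ v → u ∈ rest X v
  ∈-rest⁺ {X} {v} {u} u∈X ¬vu = ∈-∖⁺ {X = X ∩ ∁ (adj G v)} (∈-∩⁺ u∈X (T-not⁺ ¬vu))

  rest⊆ : ∀ {X v} → rest X v ⊆ X
  rest⊆ {X} u u∈ = proj₁ (∈-rest⁻ {X} u∈)

  deg-rest-drops : ∀ {X v a w} → a ∈ nbrs X v → Adj G w a → suc (deg (rest X v) w) ℕ.≤ deg X w
  deg-rest-drops {X} {v} {a} {w} a∈ wa with a∈X , va ← ∈-∩⁻ a∈ = begin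
    suc (deg (rest X v) w)                      ≤⟨ s≤s (deg-mono avoid w) ⟩
    suc (deg (X ∖ a) w)
      ≡⟨ cong (λ b → indicator b ℕ.+ deg (X ∖ a) w) (Equivalence.to T-≡ wa) ⟨
    indicator (adj G w a) ℕ.+ deg (X ∖ a) w     ≡⟨ ∑∈-remove {X = X} _ a∈X ⟨
    deg X w                                     ∎
    where
    open ℕₚ.≤-Reasoning
    avoid : rest X v ⊆ X ∖ a
    avoid u u∈ with u∈X , ¬vu , _ ← ∈-rest⁻ {X} u∈ = ∈-∖⁺ {X = X} u∈X λ { refl → ¬vu va }

  ∑∈-rest : ∀ {X v} (f : Fin n → ℕ) → v ∈ X →
            ∑∈ X f ≡ f v ℕ.+ (∑∈ (nbrs X v) f ℕ.+ ∑∈ (rest X v) f)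
  ∑∈-rest {X} {v} f v∈X = begin
    ∑∈ X f                                              ≡⟨ ∑∈-split X (adj G v) f ⟩
    ∑∈ (nbrs X v) f ℕ.+ ∑∈ (X ∩ ∁ (adj G v)) f          ≡⟨ cong (∑∈ (nbrs X v) f ℕ.+_)
                                                            (∑∈-remove {X = X ∩ ∁ (adj G v)} f v∈) ⟩
    ∑∈ (nbrs X v) f ℕ.+ (f v ℕ.+ ∑∈ (rest X v) f)       ≡⟨ swap (∑∈ (nbrs X v) f) (f v) _ ⟩
    f v ℕ.+ (∑∈ (nbrs X v) f ℕ.+ ∑∈ (rest X v) f)       ∎
    where
    open ≡-Reasoning
    -- Without loops, `v` lies among its own non-neighbours and can be split off from them.
    v∈ : v ∈ X ∩ ∁ (adj G v)
    v∈ = ∈-∩⁺ v∈X (subst (T ∘ not) (sym (loopless G v)) tt)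
    swap : ∀ a b c → a ℕ.+ (b ℕ.+ c) ≡ b ℕ.+ (a ℕ.+ c)
    swap = solve-∀

  size-rest : ∀ {X v} → v ∈ X → size X ≡ suc (deg X v ℕ.+ size (rest X v))
  size-rest {X} {v} v∈X =
    trans (∑∈-rest (λ _ → 1) v∈X) (cong (λ d → suc (d ℕ.+ size (rest X v))) (sym (deg≡size-nbrs X v)))

  rest-smaller : ∀ {X v} → v ∈ X → size (rest X v) ℕ.< size X
  rest-smaller {X} {v} v∈X = subst (size (rest X v) ℕ.<_) (sym (size-rest v∈X)) (s≤s (ℕₚ.m≤n+m _ _))

  -- The hypothesis is positive total deficiency; if all degrees were at least 3, the degree sum
  -- would reach three times the size.
  low-degree-vertex : ∀ {X} → 1 ℕ.+ degreeSum X ℕ.≤ 3 ℕ.* size X → ∃ λ v → v ∈ X × deg X v ℕ.≤ 2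
  low-degree-vertex {X} few with any? (λ v → T? (X v) ×-dec (deg X v ≤? 2))
  ... | yes low = low
  ... | no ¬low = contradiction few (ℕₚ.<⇒≱ (s≤s (begin
    3 ℕ.* size X                            ≡⟨ ∑∈-const X 3 ⟩
    ∑∈ X (λ _ → 3)                          ≤⟨ ∑∈-mono (λ u u∈X → ℕₚ.≰⇒> λ ≤2 → ¬low (u , u∈X , ≤2)) ⟩
    degreeSum X                             ∎)))
    where
    open ℕₚ.≤-Reasoning

  -- Independent sets and the surplus

  Indep : VSet n → Set
  Indep I = ∀ u w → u ∈ I → w ∈ I → ¬ Adj G u w

  -- Doubled, so that the degree sum replaces the number of edges: e - 6n + 13α ≥ k.
  Surplus : ℕ → VSet n → Set
  Surplus k X = ∃ λ I → I ⊆ X × Indep I ×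
    12 ℕ.* size X ℕ.+ 2 ℕ.* k ℕ.≤ degreeSum X ℕ.+ 26 ℕ.* size I

  Surplus-mono : ∀ {X j k} → j ℕ.≤ k → Surplus k X → Surplus j X
  Surplus-mono {X} j≤k (I , I⊆X , ind , le) =
    I , I⊆X , ind , ℕₚ.≤-trans (ℕₚ.+-monoʳ-≤ (12 ℕ.* size X) (ℕₚ.*-monoʳ-≤ 2 j≤k)) le

  -- The effect of a deletion in a triangle-free graph

  module _ (tf : TriangleFree G) where

    ¬adj-nbrs : ∀ {v a b} → Adj G v a → Adj G v b → ¬ Adj G a b
    ¬adj-nbrs {v} {a} {b} va vb ab = tf v a b (va , ab , vb)

    -- A vertex `w` behind the neighbour `a` is not adjacent to `v`, as that would close a triangle,
    -- so it survives the deletion around `v`; it loses at least the edge to `a`. This produces the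
    -- low-degree vertices that the induction feeds on.
    second-nbr : ∀ {X v a w q} → a ∈ nbrs X v → w ∈ nbrs X a → w ≢ v → deg X w ℕ.≤ suc q →
                 w ∈ rest X v × deg (rest X v) w ℕ.≤ q
    second-nbr {X} a∈ w∈ w≢v ≤q with _ , va ← ∈-∩⁻ a∈ with w∈X , aw ← ∈-∩⁻ w∈ =
      ∈-rest⁺ {X} w∈X (¬adj-nbrs (adj-sym va) aw) w≢v ,
      ℕ.s≤s⁻¹ (ℕₚ.≤-trans (deg-rest-drops a∈ (adj-sym aw)) ≤q)

    -- The edges lost are those that meet the neighbourhood of `v`. Since it is independent, its
    -- degree sum counts each of them once.
    degreeSum-rest : ∀ {X v} → v ∈ X →
                     degreeSum X ≡ 2 ℕ.* nbrDegreeSum X v ℕ.+ degreeSum (rest X v)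
    degreeSum-rest {X} {v} v∈X = begin
      degreeSum X                                    ≡⟨ ∑∈-rest (deg X) v∈X ⟩
      deg X v ℕ.+ (z ℕ.+ ∑∈ Y (deg X))               ≡⟨ cong (λ s → deg X v ℕ.+ (z ℕ.+ s)) from-rest ⟩
      deg X v ℕ.+ (z ℕ.+ (t ℕ.+ degreeSum Y))        ≡⟨ regroup (deg X v) z t (degreeSum Y) ⟩
      z ℕ.+ (deg X v ℕ.+ t) ℕ.+ degreeSum Y          ≡⟨ cong (λ s → z ℕ.+ s ℕ.+ degreeSum Y) from-nbrs ⟨
      z ℕ.+ z ℕ.+ degreeSum Y                        ≡⟨ cong (ℕ._+ degreeSum Y) (double z) ⟩
      2 ℕ.* z ℕ.+ degreeSum Y                        ∎
      where
      open ≡-Reasoning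
      Y = rest X v
      N = nbrs X v
      z = nbrDegreeSum X v
      t = ∑∈ N (deg Y)
      regroup : ∀ d z t e → d ℕ.+ (z ℕ.+ (t ℕ.+ e)) ≡ z ℕ.+ (d ℕ.+ t) ℕ.+ e
      regroup = solve-∀
      double : ∀ z → z ℕ.+ z ≡ 2 ℕ.* z
      double = solve-∀
      indicator-false : ∀ {b} → ¬ T b → indicator b ≡ 0
      indicator-false {true}  ¬b = ⊥-elim (¬b tt)
      indicator-false {false} ¬b = refl
      split : ∀ w → deg X w ≡ indicator (adj G w v) ℕ.+ (deg N w ℕ.+ deg Y w)
      split w = ∑∈-rest (λ u → indicator (adj G w u)) v∈X
      -- Vertices of `Y` have no edge to `v`; their edges into `N` are counted again from the side
      -- of `N`, which gives `t`.
      from-rest : ∑∈ Y (deg X) ≡ t ℕ.+ degreeSum Y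
      from-rest = begin
        ∑∈ Y (deg X)                            ≡⟨ ∑∈-cong (λ w w∈Y → trans (split w)
             (cong (ℕ._+ (deg N w ℕ.+ deg Y w))
               (indicator-false (proj₁ (proj₂ (∈-rest⁻ {X} w∈Y)) ∘ adj-sym)))) ⟩
        ∑∈ Y (λ w → deg N w ℕ.+ deg Y w)        ≡⟨ ∑∈-+ Y (deg N) (deg Y) ⟩
        ∑∈ Y (deg N) ℕ.+ degreeSum Y            ≡⟨ cong (ℕ._+ degreeSum Y) (∑∈-comm Y N _) ⟩
        ∑∈ N (λ u → ∑∈ Y (λ w → indicator (adj G w u))) ℕ.+ degreeSum Y
          ≡⟨ cong (ℕ._+ degreeSum Y)
               (∑∈-cong {X = N} (λ u _ → ∑∈-cong {X = Y} (λ w _ → cong indicator (symmetric G w u)))) ⟩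
        t ℕ.+ degreeSum Y                       ∎
      -- Each neighbour has one edge to `v`, none inside `N`, and the others into `Y`.
      from-nbrs : z ≡ deg X v ℕ.+ t
      from-nbrs = begin
        ∑∈ N (deg X)                  ≡⟨ ∑∈-cong at-nbr ⟩
        ∑∈ N (λ u → 1 ℕ.+ deg Y u)    ≡⟨ ∑∈-+ N (λ _ → 1) (deg Y) ⟩
        size N ℕ.+ t                  ≡⟨ cong (ℕ._+ t) (deg≡size-nbrs X v) ⟨
        deg X v ℕ.+ t                 ∎
        where
        at-nbr : ∀ u → u ∈ N → deg X u ≡ 1 ℕ.+ deg Y u
        at-nbr u u∈N with _ , vu ← ∈-∩⁻ u∈N = trans (split u) (cong₂ (λ i s → i ℕ.+ (s ℕ.+ deg Y u))
          (cong indicator (Equivalence.to T-≡ (adj-sym vu)))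
          (∑∈-zero (λ w w∈N → indicator-false (¬adj-nbrs vu (proj₂ (∈-∩⁻ w∈N))))))

    -- Adding `v` to the independent set brings 13, the deleted edges bring at least `p`, and the
    -- deleted vertices cost 6(d + 1): a net change of at least p + 7 - 6d. At numerals the hidden
    -- side condition evaluates to the unit type, so it is filled in automatically.
    Surplus-rest : ∀ d p j k {_ : T (j ℕ.+ 6 ℕ.* suc d ≤ᵇ k ℕ.+ p ℕ.+ 13)} {X v} → v ∈ X →
      deg X v ≡ d → p ℕ.≤ nbrDegreeSum X v → Surplus k (rest X v) → Surplus j X
    Surplus-rest d p j k {gain} {X} {v} v∈X refl p≤z (I , I⊆Y , ind , le) =
      insert v I , insert⊆ , insert-indep , bound
      where
      Y = rest X v
      z = nbrDegreeSum X v
      v∉I : v ∉ I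
      v∉I v∈I = proj₂ (proj₂ (∈-rest⁻ {X} (I⊆Y v v∈I))) refl
      cases : ∀ {u} → u ∈ insert v I → (u ≢ v → u ∈ I)
      cases {u} u∈ u≢v with Equivalence.to T-∨ u∈
      ... | inj₁ u∈I = u∈I
      ... | inj₂ u≡v rewrite dec-false (u ≟ v) u≢v = ⊥-elim u≡v
      insert⊆ : insert v I ⊆ X
      insert⊆ u u∈ with u ≟ v
      ... | yes refl = v∈X
      ... | no u≢v   = rest⊆ {X} u (I⊆Y u (cases-no u∈))
        where
        cases-no : T (I u ∨ false) → u ∈ I
        cases-no p with I u
        ... | true = tt
      v≁I : ∀ {w} → w ∈ I → ¬ Adj G v w
      v≁I w∈I = proj₁ (proj₂ (∈-rest⁻ {X} (I⊆Y _ w∈I)))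
      insert-indep : Indep (insert v I)
      insert-indep u w u∈ w∈ = pairs (u ≟ v) (w ≟ v)
        where
        pairs : Dec (u ≡ v) → Dec (w ≡ v) → ¬ Adj G u w
        pairs (yes refl) (yes refl) uw = adj⇒≢ uw refl
        pairs (yes refl) (no w≢v)   = v≁I (cases w∈ w≢v)
        pairs (no u≢v)   (yes refl) = v≁I (cases u∈ u≢v) ∘ adj-sym
        pairs (no u≢v)   (no w≢v)   = ind u w (cases u∈ u≢v) (cases w∈ w≢v)
      gain′ : j ℕ.+ 6 ℕ.* suc (deg X v) ℕ.≤ k ℕ.+ z ℕ.+ 13
      gain′ = ℕₚ.≤-trans (ℕₚ.≤ᵇ⇒≤ _ _ gain) (ℕₚ.+-monoˡ-≤ 13 (ℕₚ.+-monoʳ-≤ k p≤z))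
      arith : ∀ d y j k z e i →
        12 ℕ.* suc (d ℕ.+ y) ℕ.+ 2 ℕ.* j ℕ.+
          (2 ℕ.* (k ℕ.+ z ℕ.+ 13) ℕ.+ (e ℕ.+ 26 ℕ.* i)) ℕ.+ 0
        ≡ 2 ℕ.* z ℕ.+ e ℕ.+ 26 ℕ.* suc i ℕ.+
          (2 ℕ.* (j ℕ.+ 6 ℕ.* suc d) ℕ.+ (12 ℕ.* y ℕ.+ 2 ℕ.* k))
      arith = solve-∀
      bound : 12 ℕ.* size X ℕ.+ 2 ℕ.* j ℕ.≤ degreeSum X ℕ.+ 26 ℕ.* size (insert v I)
      bound rewrite size-rest {X} v∈X | degreeSum-rest {X} v∈X | size-insert {I = I} v∉I =
        -- Twice `gain′` is added to the doubled bound for `I`; the two sides then balance with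
        -- slack 0.
        ≤-combine _ (2 ℕ.* z ℕ.+ degreeSum Y ℕ.+ 26 ℕ.* suc (size I)) 0
          (ℕₚ.+-mono-≤ (ℕₚ.*-monoʳ-≤ 2 gain′) le)
          (arith (deg X v) (size Y) j k z (degreeSum Y) (size I))

    -- Here `c` and `c′` are lower bounds for the total deficiency. The d + 1 deleted vertices take
    -- 3(d + 1) from it, and the drop of the degree sum by 2z gives back at least 2p.
    deficiency-rest : ∀ d p c c′ {_ : T (c′ ℕ.+ 3 ℕ.* suc d ≤ᵇ c ℕ.+ 2 ℕ.* p)} {X v} → v ∈ X →
      deg X v ≡ d → p ℕ.≤ nbrDegreeSum X v →
      c ℕ.+ degreeSum X ℕ.≤ 3 ℕ.* size X → c′ ℕ.+ degreeSum (rest X v) ℕ.≤ 3 ℕ.* size (rest X v)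
    deficiency-rest d p c c′ {gain} {X} {v} v∈X refl p≤z le
      rewrite size-rest {X} v∈X | degreeSum-rest {X} v∈X =
        ≤-combine (c′ ℕ.+ degreeSum Y) (3 ℕ.* size Y) 0 (ℕₚ.+-mono-≤ le gain′)
          (arith (deg X v) (size Y) c c′ z (degreeSum Y))
      where
      Y = rest X v
      z = nbrDegreeSum X v
      gain′ : c′ ℕ.+ 3 ℕ.* suc (deg X v) ℕ.≤ c ℕ.+ 2 ℕ.* z
      gain′ = ℕₚ.≤-trans (ℕₚ.≤ᵇ⇒≤ _ _ gain) (ℕₚ.+-monoʳ-≤ c (ℕₚ.*-monoʳ-≤ 2 p≤z))
      arith : ∀ d y c c′ z e →
        c′ ℕ.+ e ℕ.+ (3 ℕ.* suc (d ℕ.+ y) ℕ.+ (c ℕ.+ 2 ℕ.* z)) ℕ.+ 0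
        ≡ 3 ℕ.* y ℕ.+ (c ℕ.+ (2 ℕ.* z ℕ.+ e) ℕ.+ (c′ ℕ.+ 3 ℕ.* suc d))
      arith = solve-∀

    -- The simultaneous induction

    record Claims (X : VSet n) : Set where
      field
        surplus₀         : Surplus 0 X
        surplus₁         : ∀ {v} → v ∈ X → deg X v ℕ.≤ 2 → Surplus 1 X
        -- Sharpens claim (B) at degree at most 1; it is called when a deletion lowers a vertex of
        -- degree 2.
        surplus₂-leaf    : ∀ {v} → v ∈ X → deg X v ℕ.≤ 1 → Surplus 2 X
        surplus₂-subcubic : (∀ u → u ∈ X → deg X u ℕ.≤ 3) →
          6 ℕ.+ degreeSum X ℕ.≤ 3 ℕ.* size X → Surplus 2 X
    open Claims

    -- The hypothesis covers all smaller sets, since `surplus₃-rest` deletes twice in succession.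
    module Step {X : VSet n} (claims : ∀ Y → size Y ℕ.< size X → Claims Y) where

      claims-rest : ∀ {v} → v ∈ X → Claims (rest X v)
      claims-rest {v} v∈X = claims (rest X v) (rest-smaller v∈X)

      -- The net change is 7 at an isolated vertex and at least 1 + 7 - 6 = 2 at a vertex of degree
      -- 1.
      surplus-leaf : ∀ {v} → v ∈ X → deg X v ℕ.≤ 1 → Surplus 2 X
      surplus-leaf {v} v∈X ≤1 with deg X v in d≡
      ... | 0 = Surplus-rest 0 0 2 0 v∈X d≡ z≤n (surplus₀ (claims-rest v∈X))
      ... | 1 with a , a∈ ← pick-nbr {X} (ℕₚ.≤-reflexive (sym d≡)) =
        Surplus-rest 1 1 2 0 v∈X d≡
          (nbrDegreeSum≥₁ a∈ (deg-positive (nbr-sym {X} v∈X a∈)))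
          (surplus₀ (claims-rest v∈X))
      surplus-leaf v∈X (s≤s ()) | suc (suc _)

      leaf? : Dec (∃ λ v → v ∈ X × deg X v ℕ.≤ 1)
      leaf? = any? (λ v → T? (X v) ×-dec (deg X v ≤? 1))

      -- Vertices of degree two: claims (B) and (C)

      module _ (δ≥2 : ∀ {u} → u ∈ X → 2 ℕ.≤ deg X u) where

        -- On the path `b`, `v`, `a`, `a′` the inner vertices have degree 2. Deleting around `v` or
        -- `a` changes the surplus by z - 5, and the far end, `a′` or `b`, survives with a smaller
        -- degree. The degrees of the ends decide the centre.
        surplus₁-step : ∀ {v a b} → v ∈ X → a ∈ nbrs X v → b ∈ nbrs X v → b ≢ a →
          deg X v ≡ 2 → deg X a ≡ 2 → Surplus 1 X
        surplus₁-step {v} {a} {b} v∈X a∈ b∈ b≢a dv da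
          with a∈X , _ ← ∈-∩⁻ a∈ with b∈X , _ ← ∈-∩⁻ b∈
          with v∈a ← nbr-sym {X} v∈X a∈
          with a′ , a′∈ , a′≢v ← pick-other-nbr {X} v∈a (ℕₚ.≤-reflexive (sym da))
          with 4 ≤? deg X a′ | 3 ≤? deg X a′ | 3 ≤? deg X b
        -- Around `a`, z is at least 2 + 4: a gain of 1.
        ... | yes 4≤a′ | _ | _ =
          Surplus-rest 2 6 1 0 a∈X da
            (nbrDegreeSum≥₂ v∈a a′∈ a′≢v (ℕₚ.≤-reflexive (sym dv)) 4≤a′)
            (surplus₀ (claims-rest a∈X))
        -- Around `v`, z is at least 2 + 3: no loss, and `a′` drops to degree at most 2.
        ... | no 4≰a′ | _ | yes 3≤b =
          let a′∈Y , low = second-nbr a∈ a′∈ a′≢v (ℕ.s≤s⁻¹ (ℕₚ.≰⇒> 4≰a′)) in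
          Surplus-rest 2 5 1 1 v∈X dv
            (nbrDegreeSum≥₂ a∈ b∈ b≢a (ℕₚ.≤-reflexive (sym da)) 3≤b)
            (surplus₁ (claims-rest v∈X) a′∈Y low)
        -- Around `a`, again no loss, and `b` drops to degree at most 1.
        ... | no _ | yes 3≤a′ | no 3≰b =
          let b∈Y , low = second-nbr v∈a b∈ b≢a (ℕ.s≤s⁻¹ (ℕₚ.≰⇒> 3≰b)) in
          Surplus-rest 2 5 1 2 a∈X da
            (nbrDegreeSum≥₂ v∈a a′∈ a′≢v (ℕₚ.≤-reflexive (sym dv)) 3≤a′)
            (surplus₂-leaf (claims-rest a∈X) b∈Y low)
        -- z may be as small as 4, a loss of 1, but `a′` drops to degree at most 1 and supplies 2.
        ... | no _ | no 3≰a′ | no _ =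
          let a′∈Y , low = second-nbr a∈ a′∈ a′≢v (ℕ.s≤s⁻¹ (ℕₚ.≰⇒> 3≰a′)) in
          Surplus-rest 2 4 1 2 v∈X dv
            (nbrDegreeSum≥₂ a∈ b∈ b≢a (δ≥2 a∈X) (δ≥2 b∈X))
            (surplus₂-leaf (claims-rest v∈X) a′∈Y low)

        surplus-2-vertex : ∀ {v} → v ∈ X → deg X v ≡ 2 → Surplus 1 X
        surplus-2-vertex {v} v∈X dv
          with a , a∈ ← pick-nbr {X} {v} (ℕₚ.≤-trans (s≤s z≤n) (δ≥2 v∈X))
          with b , b∈ , b≢a ← pick-other-nbr {X} a∈ (δ≥2 v∈X)
          with 3 ≤? deg X a | 3 ≤? deg X b
        ... | yes 3≤a | yes 3≤b =
          Surplus-rest 2 6 1 0 v∈X dv (nbrDegreeSum≥₂ a∈ b∈ b≢a 3≤a 3≤b) (surplus₀ (claims-rest v∈X))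
        ... | no 3≰a | _ = surplus₁-step v∈X a∈ b∈ b≢a dv
          (ℕₚ.≤-antisym (ℕ.s≤s⁻¹ (ℕₚ.≰⇒> 3≰a)) (δ≥2 (proj₁ (∈-∩⁻ a∈))))
        ... | _ | no 3≰b = surplus₁-step v∈X b∈ a∈ (b≢a ∘ sym) dv
          (ℕₚ.≤-antisym (ℕ.s≤s⁻¹ (ℕₚ.≰⇒> 3≰b)) (δ≥2 (proj₁ (∈-∩⁻ b∈))))

        module _ (Δ≤3 : ∀ u → u ∈ X → deg X u ℕ.≤ 3)
                 (deficient : 6 ℕ.+ degreeSum X ℕ.≤ 3 ℕ.* size X) where

          -- With z at least 5 nothing is lost, and the deficiency changes by at least 10 - 9, so
          -- claim (C) applies again.
          surplus₂-cut : ∀ {v} → v ∈ X → deg X v ≡ 2 → 5 ℕ.≤ nbrDegreeSum X v → Surplus 2 X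
          surplus₂-cut {v} v∈X dv 5≤z = Surplus-rest 2 5 2 2 v∈X dv 5≤z
            (surplus₂-subcubic (claims-rest v∈X)
              (λ u u∈ → ℕₚ.≤-trans (deg-mono (rest⊆ {X}) u) (Δ≤3 u (rest⊆ {X} u u∈)))
              (deficiency-rest 2 5 6 6 v∈X dv 5≤z deficient))

          -- The third unit pays for a deletion around `v` with z = 4. Deleting around `w` gains 7
          -- if it is isolated; otherwise it gains 2, and claim (B) must give one more.
          surplus₃-rest : ∀ {v w} → v ∈ X → deg X v ≡ 2 → 4 ℕ.≤ nbrDegreeSum X v →
            w ∈ rest X v → deg (rest X v) w ℕ.≤ 1 → Surplus 3 (rest X v)
          surplus₃-rest {v} {w} v∈X dv 4≤z w∈Y ≤1 with deg (rest X v) w in dw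
          ... | 0 = Surplus-rest 0 0 3 0 w∈Y dw z≤n
            (surplus₀ (claims _ (ℕₚ.<-trans (rest-smaller w∈Y) (rest-smaller v∈X))))
          ... | 1
            with x , x∈ ← pick-nbr {rest X v} (ℕₚ.≤-reflexive (sym dw))
            with 1≤z ← nbrDegreeSum≥₁ x∈ (deg-positive (nbr-sym {rest X v} w∈Y x∈))
            -- The deficiency stays at least 6 + 8 - 9 = 5 after the first deletion and 5 + 2 - 6 =
            -- 1 after the second, so some degree is at most 2.
            with u , u∈W , low ← low-degree-vertex {rest (rest X v) w}
                   (deficiency-rest 1 1 5 1 w∈Y dw 1≤z
                     (deficiency-rest 2 4 6 5 v∈X dv 4≤z deficient))
            = Surplus-rest 1 1 3 1 w∈Y dw 1≤z
                (surplus₁ (claims _ (ℕₚ.<-trans (rest-smaller w∈Y) (rest-smaller v∈X))) u∈W low)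
          surplus₃-rest v∈X dv 4≤z w∈Y (s≤s ()) | suc (suc _)

          -- If `a` or `a′` has degree at least 3, then z is at least 5 around `v` or around `a`.
          -- Otherwise a deletion around `v` leaves `a′` with degree at most 1, as `surplus₃-rest`
          -- requires.
          surplus₂-2-vertex : ∀ {v} → v ∈ X → deg X v ≡ 2 → Surplus 2 X
          surplus₂-2-vertex {v} v∈X dv
            with a , a∈ ← pick-nbr {X} {v} (ℕₚ.≤-trans (s≤s z≤n) (δ≥2 v∈X))
            with b , b∈ , b≢a ← pick-other-nbr {X} a∈ (δ≥2 v∈X)
            with a∈X , _ ← ∈-∩⁻ a∈ with b∈X , _ ← ∈-∩⁻ b∈
            with v∈a ← nbr-sym {X} v∈X a∈
            with a′ , a′∈ , a′≢v ← pick-other-nbr {X} v∈a (δ≥2 a∈X)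
            with 3 ≤? deg X a | 3 ≤? deg X a′
          ... | yes 3≤a | _ =
            surplus₂-cut v∈X dv (nbrDegreeSum≥₂ a∈ b∈ b≢a 3≤a (δ≥2 b∈X))
          ... | no 3≰a | yes 3≤a′ =
            surplus₂-cut a∈X (ℕₚ.≤-antisym (ℕ.s≤s⁻¹ (ℕₚ.≰⇒> 3≰a)) (δ≥2 a∈X))
              (nbrDegreeSum≥₂ v∈a a′∈ a′≢v (δ≥2 v∈X) 3≤a′)
          ... | no _ | no 3≰a′
            with a′∈Y , low ← second-nbr a∈ a′∈ a′≢v (ℕ.s≤s⁻¹ (ℕₚ.≰⇒> 3≰a′))
            with 4≤z ← nbrDegreeSum≥₂ a∈ b∈ b≢a (δ≥2 a∈X) (δ≥2 b∈X)
            = Surplus-rest 2 4 2 3 v∈X dv 4≤z (surplus₃-rest v∈X dv 4≤z a′∈Y low)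

      surplus-low : ∀ {v} → v ∈ X → deg X v ℕ.≤ 2 → Surplus 1 X
      surplus-low {v} v∈X ≤2 with leaf?
      ... | yes (u , u∈X , ≤1) = Surplus-mono {k = 2} (s≤s z≤n) (surplus-leaf u∈X ≤1)
      ... | no ¬leaf = surplus-2-vertex δ≥2 v∈X (ℕₚ.≤-antisym ≤2 (δ≥2 v∈X))
        where
        δ≥2 : ∀ {u} → u ∈ X → 2 ℕ.≤ deg X u
        δ≥2 {u} u∈X = ℕₚ.≰⇒> λ ≤1 → ¬leaf (u , u∈X , ≤1)

      surplus-subcubic : (∀ u → u ∈ X → deg X u ℕ.≤ 3) →
        6 ℕ.+ degreeSum X ℕ.≤ 3 ℕ.* size X → Surplus 2 X
      surplus-subcubic Δ≤3 deficient with leaf?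
      ... | yes (u , u∈X , ≤1) = surplus-leaf u∈X ≤1
      ... | no ¬leaf
        with v , v∈X , ≤2 ← low-degree-vertex {X} (ℕₚ.≤-trans (ℕₚ.m≤n+m (suc (degreeSum X)) 5) deficient)
        = surplus₂-2-vertex δ≥2 Δ≤3 deficient v∈X (ℕₚ.≤-antisym ≤2 (δ≥2 v∈X))
        where
        δ≥2 : ∀ {u} → u ∈ X → 2 ℕ.≤ deg X u
        δ≥2 {u} u∈X = ℕₚ.≰⇒> λ ≤1 → ¬leaf (u , u∈X , ≤1)

      -- Degeneracy and claim (A)

      module _ (degenerate : ∀ S → ∃ (_∈ S) → ∃ λ u → u ∈ S × deg S u ℕ.≤ 3) where

        module _ (δ≥3 : ∀ {u} → u ∈ X → 3 ℕ.≤ deg X u) where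

          -- At degree 3 the change is z - 11. Around `v`, z is at least 4 + 3 + 3 = 10, so either
          -- one more unit is found nearby or claim (B) repays the loss of 1.
          surplus-3-vertex : ∀ {v c} → v ∈ X → deg X v ≡ 3 → c ∈ nbrs X v → 4 ℕ.≤ deg X c → Surplus 0 X
          surplus-3-vertex {v} {c} v∈X dv c∈ 4≤c
            with a , b , a∈∖ , b∈∖ , b≢a ← pick-two-more-nbrs {X} c∈ (ℕₚ.≤-reflexive (sym dv))
            with a∈ , _ ← a∈∖ with b∈ , _ ← b∈∖
            with a∈X , _ ← ∈-∩⁻ a∈ with b∈X , _ ← ∈-∩⁻ b∈
            with 4 ≤? deg X a
          ... | yes 4≤a = Surplus-rest 3 11 0 0 v∈X dv
            (nbrDegreeSum≥₃ c∈ a∈∖ b∈∖ b≢a 4≤c 4≤a (δ≥3 b∈X)) (surplus₀ (claims-rest v∈X))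
          ... | no 4≰a
            with v∈a ← nbr-sym {X} v∈X a∈
            with w , x , w∈∖ , x∈∖ , x≢w ← pick-two-more-nbrs {X} v∈a (δ≥3 a∈X)
            with w∈ , w≢v ← w∈∖ with x∈ , x≢v ← x∈∖
            with 4 ≤? deg X w | 4 ≤? deg X x
          -- Recentring at `a`, now of degree 3, gives z at least 3 + 4 + 4 = 11.
          ... | yes 4≤w | yes 4≤x =
            Surplus-rest 3 11 0 0 a∈X (ℕₚ.≤-antisym (ℕ.s≤s⁻¹ (ℕₚ.≰⇒> 4≰a)) (δ≥3 a∈X))
              (nbrDegreeSum≥₃ v∈a w∈∖ x∈∖ x≢w (δ≥3 v∈X) 4≤w 4≤x) (surplus₀ (claims-rest a∈X))
          -- `w` has degree at most 3 and loses its edge to `a`, so claim (B) applies to it.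
          ... | no 4≰w | _ =
            let w∈Y , low = second-nbr a∈ w∈ w≢v (ℕ.s≤s⁻¹ (ℕₚ.≰⇒> 4≰w)) in
            Surplus-rest 3 10 0 1 v∈X dv
              (nbrDegreeSum≥₃ c∈ a∈∖ b∈∖ b≢a 4≤c (δ≥3 a∈X) (δ≥3 b∈X))
              (surplus₁ (claims-rest v∈X) w∈Y low)
          ... | _ | no 4≰x =
            let x∈Y , low = second-nbr a∈ x∈ x≢v (ℕ.s≤s⁻¹ (ℕₚ.≰⇒> 4≰x)) in
            Surplus-rest 3 10 0 1 v∈X dv
              (nbrDegreeSum≥₃ c∈ a∈∖ b∈∖ b≢a 4≤c (δ≥3 a∈X) (δ≥3 b∈X))
              (surplus₁ (claims-rest v∈X) x∈Y low)

          -- With z = 9 the loss is 2, and the deficiency rises from 0 to 18 - 12 = 6, the threshold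
          -- of claim (C).
          surplus-cubic : (∀ u → u ∈ X → deg X u ℕ.≤ 3) → ∀ {v} → v ∈ X → Surplus 0 X
          surplus-cubic Δ≤3 {v} v∈X
            with a , a∈ ← pick-nbr {X} {v} (ℕₚ.≤-trans (s≤s z≤n) (δ≥3 v∈X))
            with b , c , b∈ , c∈ , c≢b ← pick-two-more-nbrs {X} a∈ (δ≥3 v∈X)
            with dv ← ℕₚ.≤-antisym (Δ≤3 v v∈X) (δ≥3 v∈X)
            with 9≤z ← nbrDegreeSum≥₃ a∈ b∈ c∈ c≢b (δ≥3 (proj₁ (∈-∩⁻ a∈)))
                         (δ≥3 (proj₁ (∈-∩⁻ (proj₁ b∈)))) (δ≥3 (proj₁ (∈-∩⁻ (proj₁ c∈))))
            = Surplus-rest 3 9 0 2 v∈X dv 9≤z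
                (surplus₂-subcubic (claims-rest v∈X)
                  (λ u u∈ → ℕₚ.≤-trans (deg-mono (rest⊆ {X}) u) (Δ≤3 u (rest⊆ {X} u u∈)))
                  (deficiency-rest 3 9 0 6 v∈X dv 9≤z degreeSum≤))
            where
            degreeSum≤ : degreeSum X ℕ.≤ 3 ℕ.* size X
            degreeSum≤ = subst (degreeSum X ℕ.≤_) (sym (∑∈-const X 3)) (∑∈-mono Δ≤3)

          big : VSet n
          big u = X u ∧ (4 ≤ᵇ deg X u)

          -- Degeneracy, applied to the subgraph induced on `big`, gives `c` with at most three
          -- neighbours there; of its at least four neighbours in `X`, one is outside.
          big-boundary : ∃ (_∈ big) → ∃₂ λ c v → c ∈ big × v ∈ nbrs X c × v ∉ big
          big-boundary nonempty with c , c∈ , ≤3 ← degenerate big nonempty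
            with any? (λ v → T? (nbrs X c v) ×-dec T? (not (big v)))
          ... | yes (v , v∈ , v∉) = c , v , c∈ , v∈ , T-not⁻ v∉
          ... | no none = contradiction (ℕₚ.≤-trans 4≤c (ℕₚ.≤-trans deg≤ ≤3)) λ { (s≤s (s≤s (s≤s ()))) }
            where
            4≤c : 4 ℕ.≤ deg X c
            4≤c = ℕₚ.≤ᵇ⇒≤ 4 _ (proj₂ (∈-∩⁻ c∈))
            nbrs⊆ : nbrs X c ⊆ nbrs big c
            nbrs⊆ u u∈ with T? (big u)
            ... | yes u∈big = ∈-∩⁺ u∈big (proj₂ (∈-∩⁻ u∈))
            ... | no u∉big = contradiction (u , u∈ , T-not⁺ u∉big) none
            deg≤ : deg X c ℕ.≤ deg big c
            deg≤ = subst₂ ℕ._≤_ (sym (deg≡size-nbrs X c)) (sym (deg≡size-nbrs big c))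
                     (∑∈-mono-⊆ (λ _ → 1) nbrs⊆)

          surplus-min-degree-3 : ∀ {v} → v ∈ X → Surplus 0 X
          surplus-min-degree-3 {v} v∈X with any? (T? ∘ big)
          ... | no cubic = surplus-cubic Δ≤3 v∈X
            where
            Δ≤3 : ∀ u → u ∈ X → deg X u ℕ.≤ 3
            Δ≤3 u u∈X = ℕ.s≤s⁻¹ (ℕₚ.≰⇒> λ 4≤u → cubic (u , ∈-∩⁺ u∈X (ℕₚ.≤⇒≤ᵇ 4≤u)))
          ... | yes nonempty with c , w , c∈big , w∈ , w∉big ← big-boundary nonempty
            with c∈X , 4≤c ← ∈-∩⁻ c∈big with w∈X , _ ← ∈-∩⁻ w∈
            = surplus-3-vertex w∈X (ℕₚ.≤-antisym ≤3 (δ≥3 w∈X)) (nbr-sym {X} c∈X w∈) (ℕₚ.≤ᵇ⇒≤ 4 _ 4≤c)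
            where
            ≤3 : deg X w ℕ.≤ 3
            ≤3 = ℕ.s≤s⁻¹ (ℕₚ.≰⇒> λ 4≤w → w∉big (∈-∩⁺ w∈X (ℕₚ.≤⇒≤ᵇ 4≤w)))

        surplus : Surplus 0 X
        surplus with any? (T? ∘ X)
        -- With no vertices, the empty independent set suffices: the left side is zero.
        ... | no X∅ = (λ _ → false) , (λ _ ()) , (λ _ _ ()) ,
          subst (λ s → 12 ℕ.* s ℕ.+ 0 ℕ.≤ degreeSum X ℕ.+ 26 ℕ.* size {n} (λ _ → false))
            (sym (size-empty X∅)) z≤n
        ... | yes (v , v∈X) with any? (λ u → T? (X u) ×-dec (deg X u ≤? 2))
        ...   | yes (u , u∈X , ≤2) = Surplus-mono {k = 1} z≤n (surplus-low u∈X ≤2)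
        ...   | no ¬low = surplus-min-degree-3 (λ u∈X → ℕₚ.≰⇒> λ ≤2 → ¬low (_ , u∈X , ≤2)) v∈X

    -- Closing the induction on the number of vertices

    module _ (degenerate : ∀ S → ∃ (_∈ S) → ∃ λ u → u ∈ S × deg S u ℕ.≤ 3) where

      all-claims : ∀ X → Acc ℕ._<_ (size X) → Claims X
      all-claims X (acc smaller) = record
        { surplus₀          = surplus degenerate
        ; surplus₁          = surplus-low
        ; surplus₂-leaf     = surplus-leaf
        ; surplus₂-subcubic = surplus-subcubic
        }
        where open Step {X} (λ Y Y<X → all-claims Y (smaller Y<X))

      surplus-all : ∀ X → Surplus 0 X
      surplus-all X = surplus₀ (all-claims X (<-wellFounded (size X)))

-- Sums versus list and subset cardinalities

-- Phrased for `tabulate f`, since `allFin` is `tabulate` of the identity and the recursion has to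
-- pass to `f ∘ suc`.
length-filter-tabulate : ∀ {m} {A : Set} {P : A → Set} (P? : Decidable P) (f : Fin m → A) →
  length (filter P? (tabulate f)) ≡ sum (λ i → indicator (does (P? (f i))))
length-filter-tabulate {zero}  P? f = refl
length-filter-tabulate {suc m} P? f with does (P? (f zero))
... | true  = cong suc (length-filter-tabulate P? (f ∘ suc))
... | false = length-filter-tabulate P? (f ∘ suc)

filter-map : {A B : Set} {P : B → Set} (P? : Decidable P) (g : A → B) (xs : List A) →
  filter P? (map g xs) ≡ map g (filter (λ x → P? (g x)) xs)
filter-map P? g []       = refl
filter-map P? g (x ∷ xs) with does (P? (g x))
... | true  = cong (g x ∷_) (filter-map P? g xs)
... | false = filter-map P? g xs

length-filter-cartesianProduct : ∀ {k m} {A B : Set} {P : A × B → Set} (P? : Decidable P)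
  (f : Fin k → A) (g : Fin m → B) →
  length (filter P? (cartesianProduct (tabulate f) (tabulate g)))
    ≡ sum (λ i → sum (λ j → indicator (does (P? (f i , g j)))))
length-filter-cartesianProduct {zero}  P? f g = refl
length-filter-cartesianProduct {suc k} P? f g = begin
  length (filter P? (map (f zero ,_) (tabulate g) ++ others))
    ≡⟨ cong length (filter-++ P? (map (f zero ,_) (tabulate g)) others) ⟩
  length (filter P? (map (f zero ,_) (tabulate g)) ++ filter P? others)
    ≡⟨ length-++ (filter P? (map (f zero ,_) (tabulate g))) ⟩
  length (filter P? (map (f zero ,_) (tabulate g))) ℕ.+ length (filter P? others)
    ≡⟨ cong₂ ℕ._+_ first-row (length-filter-cartesianProduct P? (f ∘ suc) g) ⟩
  sum (λ i → sum (λ j → indicator (does (P? (f i , g j)))))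
    ∎
  where
  open ≡-Reasoning
  others = cartesianProduct (tabulate (f ∘ suc)) (tabulate g)
  first-row : length (filter P? (map (f zero ,_) (tabulate g)))
            ≡ sum (λ j → indicator (does (P? (f zero , g j))))
  first-row = begin
    length (filter P? (map (f zero ,_) (tabulate g)))
      ≡⟨ cong length (filter-map P? (f zero ,_) (tabulate g)) ⟩
    length (map (f zero ,_) (filter (λ y → P? (f zero , y)) (tabulate g)))
      ≡⟨ length-map (f zero ,_) (filter (λ y → P? (f zero , y)) (tabulate g)) ⟩
    length (filter (λ y → P? (f zero , y)) (tabulate g))
      ≡⟨ length-filter-tabulate (λ y → P? (f zero , y)) g ⟩
    sum (λ j → indicator (does (P? (f zero , g j))))
      ∎

full : VSet n
full _ = true

size-full : ∀ n → size {n} full ≡ n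
size-full n = trans (∑∈-sum full (λ _ → 1)) (ones n)
  where
  ones : ∀ n → sum {n} (λ _ → 1) ≡ n
  ones zero    = refl
  ones (suc n) = cong suc (ones n)

∣tabulate∣ : (X : VSet n) → Sub.∣ Vec.tabulate X ∣ ≡ size X
∣tabulate∣ X = trans (count X) (sym (∑∈-sum X (λ _ → 1)))
  where
  count : ∀ {m} (X : VSet m) → Sub.∣ Vec.tabulate X ∣ ≡ sum (λ u → indicator (X u))
  count {zero}  X = refl
  count {suc m} X with X zero
  ... | true  = cong suc (count (X ∘ suc))
  ... | false = count (X ∘ suc)

∈-tabulate⁺ : {X : VSet n} {u : Fin n} → u ∈ X → u Sub.∈ Vec.tabulate X
∈-tabulate⁺ {X = X} {u} u∈X =
  Vecₚ.lookup⇒[]= u (Vec.tabulate X) (trans (Vecₚ.lookup∘tabulate X u) (Equivalence.to T-≡ u∈X))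

∈-tabulate⁻ : {X : VSet n} {u : Fin n} → u Sub.∈ Vec.tabulate X → u ∈ X
∈-tabulate⁻ {X = X} {u} u∈ =
  Equivalence.from T-≡ (trans (sym (Vecₚ.lookup∘tabulate X u)) (Vecₚ.[]=⇒lookup u∈))

-- The statement excludes independent sets of exactly `r` vertices, so larger ones must be trimmed.
subset-of-size : (S : Sub.Subset n) (r : ℕ) → r ℕ.≤ Sub.∣ S ∣ →
                 ∃ λ R → R Sub.⊆ S × Sub.∣ R ∣ ≡ r
subset-of-size {n} S zero _ = Sub.⊥ , Subₚ.⊥⊆ , Subₚ.∣⊥∣≡0 n
subset-of-size (true Vec.∷ S) (suc r) r≤ with R , R⊆S , eq ← subset-of-size S r (ℕ.s≤s⁻¹ r≤) =
  true Vec.∷ R , Subₚ.s⊆s R⊆S , cong suc eq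
subset-of-size (false Vec.∷ S) (suc r) r≤ with R , R⊆S , eq ← subset-of-size S (suc r) r≤ =
  false Vec.∷ R , Subₚ.s⊆s R⊆S , eq

-- The notions of the statement expressed as sums

module _ (G : Graph n) where

  degreeIn≡deg : (X : VSet n) (v : Fin n) → degreeIn G (Vec.tabulate X) v ≡ deg G X v
  degreeIn≡deg X v = begin
    degreeIn G (Vec.tabulate X) v
      ≡⟨ length-filter-tabulate (λ u → T? (adj G v u ∧ Vec.lookup (Vec.tabulate X) u)) (λ u → u) ⟩
    sum (λ u → indicator (adj G v u ∧ Vec.lookup (Vec.tabulate X) u))
      ≡⟨ sum-cong-≗ pointwise ⟩
    sum (λ u → if X u then indicator (adj G v u) else 0)
      ≡⟨ ∑∈-sum X (λ u → indicator (adj G v u)) ⟨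
    deg G X v ∎
    where
    open ≡-Reasoning
    pointwise : ∀ u → indicator (adj G v u ∧ Vec.lookup (Vec.tabulate X) u)
                    ≡ (if X u then indicator (adj G v u) else 0)
    pointwise u rewrite Vecₚ.lookup∘tabulate X u with adj G v u | X u
    ... | true  | true  = refl
    ... | true  | false = refl
    ... | false | true  = refl
    ... | false | false = refl

  edge? : ∀ i j → Dec (i Fin.< j × Adj G i j)
  edge? i j = (i Finₚ.<? j) ×-dec T? (adj G i j)

  -- The handshake identity. `orient` splits every adjacency by which endpoint is smaller, loops
  -- being absent, and exchanging the sums makes the two halves equal.
  degreeSum-full : degreeSum G full ≡ 2 ℕ.* edgeCount G
  degreeSum-full = begin
    degreeSum G full
      ≡⟨ ∑∈-sum full (deg G full) ⟩
    sum (deg G full)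
      ≡⟨ sum-cong-≗ (λ i → ∑∈-sum full (λ j → indicator (adj G i j))) ⟩
    sum (λ i → sum (λ j → indicator (adj G i j)))
      ≡⟨ sum-cong-≗ (λ i → trans (sum-cong-≗ (orient i))
           (∑-distrib-+ (λ j → indicator (does (edge? i j))) (λ j → indicator (does (edge? j i))))) ⟩
    sum (λ i → sum (λ j → indicator (does (edge? i j))) ℕ.+ sum (λ j → indicator (does (edge? j i))))
      ≡⟨ ∑-distrib-+ (λ i → sum (λ j → indicator (does (edge? i j))))
                     (λ i → sum (λ j → indicator (does (edge? j i)))) ⟩
    count ℕ.+ sum (λ i → sum (λ j → indicator (does (edge? j i))))
      ≡⟨ cong (count ℕ.+_) (∑-comm (λ i j → indicator (does (edge? j i)))) ⟩
    count ℕ.+ count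
      ≡⟨ cong (count ℕ.+_) (ℕₚ.+-identityʳ count) ⟨
    2 ℕ.* count
      ≡⟨ cong (2 ℕ.*_) (length-filter-cartesianProduct (λ p → edge? (proj₁ p) (proj₂ p)) (λ i → i) (λ j → j)) ⟨
    2 ℕ.* edgeCount G ∎
    where
    open ≡-Reasoning
    count : ℕ
    count = sum (λ i → sum (λ j → indicator (does (edge? i j))))
    orient : ∀ i j → indicator (adj G i j) ≡ indicator (does (edge? i j)) ℕ.+ indicator (does (edge? j i))
    orient i j with Finₚ.<-cmp i j
    ... | tri< i<j _ j≮i
      rewrite dec-true (i Finₚ.<? j) i<j | dec-false (j Finₚ.<? i) j≮i = sym (ℕₚ.+-identityʳ _)
    ... | tri> i≮j _ j<i
      rewrite dec-false (i Finₚ.<? j) i≮j | dec-true (j Finₚ.<? i) j<i | symmetric G j i = refl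
    ... | tri≈ i≮i refl _
      rewrite dec-false (i Finₚ.<? i) i≮i | loopless G i = refl

  degenerate-VSet : ∀ {k} → Degenerate k G → ∀ S → ∃ (_∈ S) → ∃ λ u → u ∈ S × deg G S u ℕ.≤ k
  degenerate-VSet dg S (v , v∈S)
    with u , u∈ , ≤k ← dg (Vec.tabulate S) (v , ∈-tabulate⁺ {X = S} v∈S) =
    u , ∈-tabulate⁻ {X = S} u∈ , subst (ℕ._≤ _) (degreeIn≡deg S u) ≤k

  independent-size< : ∀ {r I} → NoIndependentSetOfSize G r → Indep G I → size I ℕ.< r
  independent-size< {r} {I} none ind = ℕₚ.≰⇒> λ r≤ →
    let R , R⊆I , ∣R∣≡r = subset-of-size (Vec.tabulate I) r (subst (r ℕ.≤_) (sym (∣tabulate∣ I)) r≤)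
    in none R (λ u v u∈ v∈ → ind u v (∈-tabulate⁻ {X = I} (R⊆I u∈)) (∈-tabulate⁻ {X = I} (R⊆I v∈))) ∣R∣≡r

-- The inequality over the naturals and over the integers

6m≤e+13r : (m r : ℕ) (G : Graph m) → Degenerate 3 G → TriangleFree G → NoIndependentSetOfSize G r →
  6 ℕ.* m ℕ.≤ edgeCount G ℕ.+ 13 ℕ.* r
6m≤e+13r m r G dg tf none with I , _ , ind , le ← surplus-all G tf (degenerate-VSet G dg) full
  rewrite size-full m | degreeSum-full G =
  ℕₚ.*-cancelˡ-≤ 2 (≤-combine (2 ℕ.* (6 ℕ.* m)) (2 ℕ.* (edgeCount G ℕ.+ 13 ℕ.* r)) 0
    (ℕₚ.+-mono-≤ le (ℕₚ.*-monoʳ-≤ 26 (ℕₚ.<⇒≤ (independent-size< G none ind))))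
    (arith m (edgeCount G) r (size I)))
  where
  arith : ∀ m e r i →
    2 ℕ.* (6 ℕ.* m) ℕ.+ (2 ℕ.* e ℕ.+ 26 ℕ.* i ℕ.+ 26 ℕ.* r) ℕ.+ 0
    ≡ 2 ℕ.* (e ℕ.+ 13 ℕ.* r) ℕ.+ (12 ℕ.* m ℕ.+ 0 ℕ.+ 26 ℕ.* i)
  arith = solve-∀

theoremA1 : (m r : ℕ) (G : Graph m) → Degenerate 3 G → TriangleFree G →
    NoIndependentSetOfSize G r →
    ((+ 6) * (+ m)) - ((+ 13) * (+ r)) - (+ 1) ≤ + edgeCount G
theoremA1 m r G dg tf none = begin
  -- The inequality proved above bounds 6m - 13r itself; subtracting one only lowers it.
  + 6 * + m - + 13 * + r - + 1                    ≤⟨ ℤₚ.i-j≤i (+ 6 * + m - + 13 * + r) (+ 1) ⟩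
  + 6 * + m - + 13 * + r                          ≡⟨ cong₂ _-_ (ℤₚ.pos-* 6 m) (ℤₚ.pos-* 13 r) ⟨
  + (6 ℕ.* m) - + (13 ℕ.* r)                      ≤⟨ ℤₚ.+-monoˡ-≤ (ℤ.- + (13 ℕ.* r))
                                                      (ℤ.+≤+ (6m≤e+13r m r G dg tf none)) ⟩
  + (edgeCount G ℕ.+ 13 ℕ.* r) - + (13 ℕ.* r)     ≡⟨ ℤₚ.m-n≡m⊖n (edgeCount G ℕ.+ 13 ℕ.* r) (13 ℕ.* r) ⟩
  (edgeCount G ℕ.+ 13 ℕ.* r) ℤ.⊖ (13 ℕ.* r)       ≡⟨ ℤₚ.⊖-≥ (ℕₚ.m≤n+m (13 ℕ.* r) (edgeCount G)) ⟩
  -- Truncated subtraction is exact here, because 13r is one of the summands.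
  + (edgeCount G ℕ.+ 13 ℕ.* r ℕ.∸ 13 ℕ.* r)       ≡⟨ cong +_ (ℕₚ.m+n∸n≡m (edgeCount G) (13 ℕ.* r)) ⟩
  + edgeCount G                                   ∎
  where open ℤₚ.≤-Reasoning
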